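{- $\mathbf{GR}$ enjoys uniform interpolation property: for every $\mathcal{L}_2$-formula $A$ and every finite set $P$ of propositional variables there is an $\mathcal{L}_2$-formula $C$ such that (1) $v(C)\subseteq v(A)\setminus P$; (2) $\mathbf{GR}\vdash A\to C$; (3) for every $\mathcal{L}_2$-formula $B$, if $\mathbf{GR}\vdash A\to B$ and $v(B)\cap P=\emptyset$, then $\mathbf{GR}\vdash C\to B$.
   Context: $\mathcal{L}_2$ is the bimodal propositional language with countably many propositional variables, $\bot$, connectives $\neg,\vee$ (others defined), and unary modal operators $\Box,\blacksquare$; $\Diamond$ abbreviates $\neg\Box\neg$; $v(A)$ denotes the set of propositional variables occurring in $A$. The logic $\mathbf{GR}^-$ has as axioms all propositional tautologies of $\mathcal{L}_2$ and all instances of $\Box(A\to B)\to(\Box A\to\Box B)$, $\Box(\Box A\to A)\to\Box A$, $\blacksquare A\to\Box A$, $\Box A\to\Box\blacksquare A$, $\Box A\to(\Box\bot\vee\blacksquare A)$, $\Diamond\blacksquare A\to\Diamond A$, and rules modus ponens and $\Box$-necessitation. $\mathbf{GR}$ is $\mathbf{GR}^-$ plus the rule: from $\Box A$ infer $A$. -}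

module Defs where

open import Data.Nat using (ℕ)
open import Data.Bool using (Bool; true; false; not; _∨_)
open import Data.List using (List)
open import Data.List.Membership.Propositional using (_∈_)
open import Data.Sum using (_⊎_)
open import Data.Empty using (⊥)
open import Relation.Nullary using (¬_)
open import Relation.Binary.PropositionalEquality using (_≡_)

data Fm : Set where
  var  : ℕ → Fm
  ⊥'   : Fm
  ¬'_  : Fm → Fm
  _∨'_ : Fm → Fm → Fm
  □_   : Fm → Fm
  ■_   : Fm → Fm

infixr 5 _∨'_
infixr 4 _⇒_

_⇒_ : Fm → Fm → Fm
A ⇒ B = (¬' A) ∨' B

◇_ : Fm → Fm
◇ A = ¬' (□ (¬' A))

-- Propositional tautologies of L₂: formulas true under every Boolean
-- valuation that assigns arbitrary truth values to propositional variables
-- and to modalized subformulas (□B, ■B), treating those as atoms.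
-- (Equivalently: substitution instances of classical tautologies.)
record Val : Set where
  field
    atom : ℕ → Bool
    box  : Fm → Bool
    bbox : Fm → Bool

eval : Val → Fm → Bool
eval V (var n)  = Val.atom V n
eval V ⊥'       = false
eval V (¬' A)   = not (eval V A)
eval V (A ∨' B) = eval V A ∨ eval V B
eval V (□ A)    = Val.box V A
eval V (■ A)    = Val.bbox V A

Taut : Fm → Set
Taut A = (V : Val) → eval V A ≡ true

data Prf (reflect : Bool) : Fm → Set where
  taut : ∀ {A} → Taut A → Prf reflect A
  axK  : ∀ {A B} → Prf reflect (□ (A ⇒ B) ⇒ (□ A ⇒ □ B))
  axL  : ∀ {A} → Prf reflect (□ (□ A ⇒ A) ⇒ □ A)
  ax1  : ∀ {A} → Prf reflect (■ A ⇒ □ A)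
  ax2  : ∀ {A} → Prf reflect (□ A ⇒ □ (■ A))
  ax3  : ∀ {A} → Prf reflect (□ A ⇒ (□ ⊥' ∨' ■ A))
  ax4  : ∀ {A} → Prf reflect (◇ (■ A) ⇒ ◇ A)
  mp   : ∀ {A B} → Prf reflect (A ⇒ B) → Prf reflect A → Prf reflect B
  nec  : ∀ {A} → Prf reflect A → Prf reflect (□ A)
  refl□ : ∀ {A} → reflect ≡ true → Prf reflect (□ A) → Prf reflect A

GR⁻⊢_ : Fm → Set
GR⁻⊢ A = Prf false A

GR⊢_ : Fm → Set
GR⊢ A = Prf true A

data _occursIn_ (n : ℕ) : Fm → Set where
  here : n occursIn var n
  inNeg : ∀ {A} → n occursIn A → n occursIn (¬' A)
  inOrL : ∀ {A B} → n occursIn A → n occursIn (A ∨' B)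
  inOrR : ∀ {A B} → n occursIn B → n occursIn (A ∨' B)
  inBox : ∀ {A} → n occursIn A → n occursIn (□ A)
  inBBox : ∀ {A} → n occursIn A → n occursIn (■ A)

{-# OPTIONS --safe #-}
module Submission where

-- GR is reduced to the Gödel–Löb logic GL by reading each ■D as a propositional atom.
-- In GR, ■D agrees with □D where □⊥ fails, and where □⊥ holds the only constraints on it
-- are □D → □(□⊥ → ■D) and □¬D → □(□⊥ → ¬■D), together with ■D (resp. ¬■D) when D (resp. ¬D)
-- is a theorem. The constraints concern one D at a time, so those for the ■-subformulas
-- of A → B split into a part for A and a part for B, and an interpolant for GR is a
-- GL-interpolant eliminating every atom, p or ■D, that mentions a variable of P.
--
-- For GL, ∃P.A is evaluated on finite trees through types (true atoms, true boxes): along a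
-- branch the set of true boxes grows, and a false box has a witness with strictly more true
-- boxes, so the formula "a copy of this tree has type τ" is definable by recursion on the
-- number of false boxes. Equality of copies is equality of truth values over the kept atoms.

open import Defs
open import Data.Bool using (Bool; true; false; not; _∧_; _∨_; if_then_else_)
open import Data.Bool.Properties using (not-involutive)
open import Data.Empty using (⊥-elim)
open import Data.Nat using (ℕ; zero; suc; _≤_; _<_; s≤s; z≤n; _≟_)
open import Data.List using (List; []; _∷_; _++_; map; filter; length; cartesianProduct)
open import Data.List.Properties using (length-filter)
open import Data.List.Membership.Propositional using (_∈_; _∉_)
open import Data.List.Membership.DecPropositional _≟_ using () renaming (_∈?_ to _∈ℕ?_)
open import Data.List.Membership.Propositional.Properties using (∈-++⁺ˡ; ∈-++⁺ʳ; ∈-++⁻; ∈-map⁺; ∈-map⁻; ∈-filter⁺; ∈-filter⁻; ∈-cartesianProduct⁺)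
open import Data.List.Relation.Unary.All using (All; all?) renaming (lookup to All-lookup; tabulate to All-tabulate)
open import Data.List.Relation.Unary.Any using (here; there)
open import Data.Nat.Properties using (≤-trans; ≤-refl; m≤n⇒m≤1+n)
open import Data.Product using (Σ; _×_; _,_; proj₁; proj₂)
open import Data.Sum using (_⊎_; inj₁; inj₂; [_,_]′)
open import Data.Unit using (⊤; tt)
open import Function using (_∘_; case_of_)
open import Relation.Binary.Definitions using (DecidableEquality)
open import Relation.Binary.PropositionalEquality using (_≡_; refl; sym; trans; cong; cong₂; subst)
open import Relation.Nullary using (¬_; Dec; yes; no; does; ¬?; _×-dec_; _→-dec_)
open import Relation.Nullary.Decidable using (map′; dec-true; dec-false; decidable-stable)
open import Relation.Unary using (Decidable)

-- Decidable equality of formulas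

infix 4 _≟F_

_≟F_ : DecidableEquality Fm
var m ≟F var n = map′ (cong var) (λ { refl → refl }) (m ≟ n)
(var _) ≟F ⊥' = no λ ()
(var _) ≟F (¬' _) = no λ ()
(var _) ≟F (_ ∨' _) = no λ ()
(var _) ≟F (□ _) = no λ ()
(var _) ≟F (■ _) = no λ ()
⊥' ≟F (var _) = no λ ()
⊥' ≟F ⊥' = yes refl
⊥' ≟F (¬' _) = no λ ()
⊥' ≟F (_ ∨' _) = no λ ()
⊥' ≟F (□ _) = no λ ()
⊥' ≟F (■ _) = no λ ()
(¬' _) ≟F (var _) = no λ ()
(¬' _) ≟F ⊥' = no λ ()
(¬' A) ≟F (¬' B) = map′ (cong ¬'_) (λ { refl → refl }) (A ≟F B)
(¬' _) ≟F (_ ∨' _) = no λ ()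
(¬' _) ≟F (□ _) = no λ ()
(¬' _) ≟F (■ _) = no λ ()
(_ ∨' _) ≟F (var _) = no λ ()
(_ ∨' _) ≟F ⊥' = no λ ()
(_ ∨' _) ≟F (¬' _) = no λ ()
(A ∨' C) ≟F (B ∨' D) = map′ (λ (p , q) → cong₂ _∨'_ p q) (λ { refl → refl , refl }) ((A ≟F B) ×-dec (C ≟F D))
(_ ∨' _) ≟F (□ _) = no λ ()
(_ ∨' _) ≟F (■ _) = no λ ()
(□ _) ≟F (var _) = no λ ()
(□ _) ≟F ⊥' = no λ ()
(□ _) ≟F (¬' _) = no λ ()
(□ _) ≟F (_ ∨' _) = no λ ()
(□ A) ≟F (□ B) = map′ (cong □_) (λ { refl → refl }) (A ≟F B)
(□ _) ≟F (■ _) = no λ ()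
(■ _) ≟F (var _) = no λ ()
(■ _) ≟F ⊥' = no λ ()
(■ _) ≟F (¬' _) = no λ ()
(■ _) ≟F (_ ∨' _) = no λ ()
(■ _) ≟F (□ _) = no λ ()
(■ A) ≟F (■ B) = map′ (cong ■_) (λ { refl → refl }) (A ≟F B)

open import Data.List.Membership.DecPropositional _≟F_ using (_∈?_)

-- Propositional reasoning under a valuation

infix 3 _⊩_
infixr 6 _∧'_

-- A record, so that unification can recover `V` and `A`; the bare equation would compute and lose
-- them.
record _⊩_ (V : Val) (A : Fm) : Set where
  constructor holds
  field
    true≡ : eval V A ≡ true
open _⊩_

_⊩?_ : ∀ V A → Dec (V ⊩ A)
V ⊩? A with eval V A in eq
... | true  = yes (holds eq)
... | false = no λ (holds p) → case trans (sym eq) p of λ ()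

⊩-stable : ∀ {V A} → ¬ ¬ (V ⊩ A) → V ⊩ A
⊩-stable {V} {A} = decidable-stable (V ⊩? A)

⊮⇒false : ∀ {V A} → ¬ (V ⊩ A) → eval V A ≡ false
⊮⇒false {V} {A} h with eval V A in eq
... | true  = ⊥-elim (h (holds eq))
... | false = refl

⊩-cong : ∀ {V W A B} → eval V A ≡ eval W B → V ⊩ A → W ⊩ B
⊩-cong e (holds p) = holds (trans (sym e) p)

eval-ext : ∀ {V W A B} → (V ⊩ A → W ⊩ B) → (W ⊩ B → V ⊩ A) → eval V A ≡ eval W B
eval-ext {V} {W} {A} {B} f g with V ⊩? A
... | yes p = trans (true≡ p) (sym (true≡ (f p)))
... | no ¬p = trans (⊮⇒false ¬p) (sym (⊮⇒false (¬p ∘ g)))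

⊤' : Fm
⊤' = ¬' ⊥'

_∧'_ : Fm → Fm → Fm
A ∧' B = ¬' ((¬' A) ∨' (¬' B))

⊡_ : Fm → Fm
⊡ A = A ∧' □ A

⊤i : ∀ {V} → V ⊩ ⊤'
⊤i = holds refl

⊥e : ∀ {V} → ¬ (V ⊩ ⊥')
⊥e (holds ())

¬i : ∀ {V A} → ¬ (V ⊩ A) → V ⊩ ¬' A
¬i h = holds (cong not (⊮⇒false h))

¬e : ∀ {V A} → V ⊩ ¬' A → ¬ (V ⊩ A)
¬e {V} {A} (holds p) (holds q) rewrite q = case p of λ ()

∨i₁ : ∀ {V A B} → V ⊩ A → V ⊩ A ∨' B
∨i₁ (holds p) = holds (cong (_∨ _) p)

∨i₂ : ∀ {V A B} → V ⊩ B → V ⊩ A ∨' B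
∨i₂ {V} {A} (holds p) with eval V A in eq
... | true  = holds (cong (_∨ _) eq)
... | false = holds (trans (cong (_∨ _) eq) p)

∨e : ∀ {V A B} → V ⊩ A ∨' B → V ⊩ A ⊎ V ⊩ B
∨e {V} {A} {B} (holds p) with V ⊩? A
... | yes q = inj₁ q
... | no ¬q = inj₂ (holds (trans (sym (cong (_∨ eval V B) (⊮⇒false ¬q))) p))

⇒i : ∀ {V A B} → (V ⊩ A → V ⊩ B) → V ⊩ A ⇒ B
⇒i {V} {A} f with V ⊩? A
... | yes p = ∨i₂ (f p)
... | no ¬p = ∨i₁ (¬i ¬p)

⇒e : ∀ {V A B} → V ⊩ A ⇒ B → V ⊩ A → V ⊩ B
⇒e h p with ∨e h
... | inj₁ q = ⊥-elim (¬e q p)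
... | inj₂ q = q

∧i : ∀ {V A B} → V ⊩ A → V ⊩ B → V ⊩ A ∧' B
∧i p q = ¬i λ h → [ (λ x → ¬e x p) , (λ x → ¬e x q) ]′ (∨e h)

∧e₁ : ∀ {V A B} → V ⊩ A ∧' B → V ⊩ A
∧e₁ h = ⊩-stable λ ¬p → ¬e h (∨i₁ (¬i ¬p))

∧e₂ : ∀ {V A B} → V ⊩ A ∧' B → V ⊩ B
∧e₂ h = ⊩-stable λ ¬p → ¬e h (∨i₂ (¬i ¬p))

⋁ : List Fm → Fm
⋁ []      = ⊥'
⋁ (A ∷ L) = A ∨' ⋁ L

⋀ : List Fm → Fm
⋀ []      = ⊤'
⋀ (A ∷ L) = A ∧' ⋀ L

⋁i : ∀ {V A L} → A ∈ L → V ⊩ A → V ⊩ ⋁ L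
⋁i (here refl) p = ∨i₁ p
⋁i (there m)   p = ∨i₂ (⋁i m p)

⋁e : ∀ {V} L → V ⊩ ⋁ L → Σ Fm λ A → A ∈ L × V ⊩ A
⋁e []      h = ⊥-elim (⊥e h)
⋁e (A ∷ L) h with ∨e h
... | inj₁ p = A , here refl , p
... | inj₂ q = let B , m , p = ⋁e L q in B , there m , p

⋀i : ∀ {V} L → (∀ {A} → A ∈ L → V ⊩ A) → V ⊩ ⋀ L
⋀i []      f = ⊤i
⋀i (A ∷ L) f = ∧i (f (here refl)) (⋀i L (f ∘ there))

⋀e : ∀ {V A L} → V ⊩ ⋀ L → A ∈ L → V ⊩ A
⋀e h (here refl) = ∧e₁ h
⋀e h (there m)   = ⋀e (∧e₂ h) m

⋁i-map : ∀ {X : Set} (f : X → Fm) {V x L} → x ∈ L → V ⊩ f x → V ⊩ ⋁ (map f L)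
⋁i-map f m p = ⋁i (∈-map⁺ f m) p

⋁e-map : ∀ {X : Set} (f : X → Fm) {V} L → V ⊩ ⋁ (map f L) → Σ X λ x → x ∈ L × V ⊩ f x
⋁e-map f L h with ⋁e (map f L) h
... | A , m , p with ∈-map⁻ f m
... | x , m′ , refl = x , m′ , p

⋀i-map : ∀ {X : Set} (f : X → Fm) {V} L → (∀ {x} → x ∈ L → V ⊩ f x) → V ⊩ ⋀ (map f L)
⋀i-map f L h = ⋀i (map f L) λ m → case ∈-map⁻ f m of λ { (_ , m′ , refl) → h m′ }

⋀e-map : ∀ {X : Set} (f : X → Fm) {V x L} → V ⊩ ⋀ (map f L) → x ∈ L → V ⊩ f x
⋀e-map f h m = ⋀e h (∈-map⁺ f m)

-- Finite trees, with ■D read as an atom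

data Tree : Set where
  node : (ℕ → Bool) → (Fm → Bool) → List Tree → Tree

children : Tree → List Tree
children (node _ _ ts) = ts

-- Asking for both `A` and `□ A` at each child makes accessibility transitive while the recursion
-- stays structural.
val : Tree → Val
allBelow : List Tree → Fm → Bool

val (node a b ts) = record { atom = a ; box = allBelow ts ; bbox = b }

allBelow []       A = true
allBelow (t ∷ ts) A = (eval (val t) A ∧ Val.box (val t) A) ∧ allBelow ts A

infix 4 _≺_
data _≺_ (u : Tree) : Tree → Set where
  child : ∀ {T} → u ∈ children T → u ≺ T
  below : ∀ {t T} → u ≺ t → t ∈ children T → u ≺ T

≺-trans : ∀ {u v w} → u ≺ v → v ≺ w → u ≺ w
≺-trans p (child m)   = below p m
≺-trans p (below q m) = below (≺-trans p q) m

∧-true : ∀ {x y} → x ≡ true → y ≡ true → x ∧ y ≡ true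
∧-true refl refl = refl

∧-true⁻ : ∀ x {y} → x ∧ y ≡ true → x ≡ true × y ≡ true
∧-true⁻ true p = refl , p

allBelow⁺ : ∀ {A} ts → (∀ {t} → t ∈ ts → val t ⊩ A × val t ⊩ □ A) → allBelow ts A ≡ true
allBelow⁺ []       h = refl
allBelow⁺ (t ∷ ts) h =
  ∧-true (∧-true (true≡ (proj₁ (h (here refl)))) (true≡ (proj₂ (h (here refl))))) (allBelow⁺ ts (h ∘ there))

allBelow⁻ : ∀ {A t} ts → allBelow ts A ≡ true → t ∈ ts → val t ⊩ A × val t ⊩ □ A
allBelow⁻ (t ∷ ts) h (here refl) =
  let p , q = ∧-true⁻ _ (proj₁ (∧-true⁻ _ h)) in holds p , holds q
allBelow⁻ (t ∷ ts) h (there m) = allBelow⁻ ts (proj₂ (∧-true⁻ _ h)) m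

□i-children : ∀ {A} T → (∀ {t} → t ∈ children T → val t ⊩ A × val t ⊩ □ A) → val T ⊩ □ A
□i-children (node _ _ ts) h = holds (allBelow⁺ ts h)

□e-children : ∀ {A t} T → val T ⊩ □ A → t ∈ children T → val t ⊩ A × val t ⊩ □ A
□e-children (node _ _ ts) (holds h) = allBelow⁻ ts h

□e : ∀ {A u T} → val T ⊩ □ A → u ≺ T → val u ⊩ A
□e {T = T} h (child m)   = proj₁ (□e-children T h m)
□e {T = T} h (below p m) = □e (proj₂ (□e-children T h m)) p

-- The search descends while `□ A` fails at some child, and trees are finite. This is Löb's axiom in
-- semantic form.
least-counterexample : ∀ {A} T → ¬ (val T ⊩ □ A) → Σ Tree λ u → u ≺ T × ¬ (val u ⊩ A) × val u ⊩ □ A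
least-counterexample {A} (node a b ts₀) h = go ts₀ (λ m → m) (h ∘ holds)
  where
  go : ∀ ts → (∀ {t} → t ∈ ts → t ∈ ts₀) → ¬ (allBelow ts A ≡ true) →
       Σ Tree λ u → u ≺ node a b ts₀ × ¬ (val u ⊩ A) × val u ⊩ □ A
  go []       ι h = ⊥-elim (h refl)
  go (t ∷ ts) ι h with val t ⊩? (□ A)
  ... | no ¬□ = let u , u≺t , w = least-counterexample t ¬□ in u , below u≺t (ι (here refl)) , w
  ... | yes p with val t ⊩? A
  ...   | no ¬q = t , child (ι (here refl)) , ¬q , p
  ...   | yes q = go ts (ι ∘ there) λ e → h (∧-true (∧-true (true≡ q) (true≡ p)) e)

□i : ∀ {A} T → (∀ {u} → u ≺ T → val u ⊩ A) → val T ⊩ □ A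
□i T h = ⊩-stable λ ¬□ → let _ , u≺T , ¬A , _ = least-counterexample T ¬□ in ¬A (h u≺T)

□-trans : ∀ {A u T} → val T ⊩ □ A → u ≺ T → val u ⊩ □ A
□-trans {u = u} h p = □i u λ q → □e h (≺-trans q p)

◇i : ∀ {A u T} → u ≺ T → val u ⊩ A → val T ⊩ ◇ A
◇i p h = ¬i λ n → ¬e (□e n p) h

◇e : ∀ {A} T → val T ⊩ ◇ A → Σ Tree λ u → u ≺ T × val u ⊩ A
◇e T h = let u , u≺T , ¬¬A , _ = least-counterexample T (¬e h) in u , u≺T , ⊩-stable (¬¬A ∘ ¬i)

Valid : Fm → Set
Valid A = ∀ T → val T ⊩ A

-- Gödel–Löb logic

data GL : Fm → Set where
  taut : ∀ {A} → Taut A → GL A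
  axK  : ∀ {A B} → GL (□ (A ⇒ B) ⇒ (□ A ⇒ □ B))
  axL  : ∀ {A} → GL (□ (□ A ⇒ A) ⇒ □ A)
  mp   : ∀ {A B} → GL (A ⇒ B) → GL A → GL B
  nec  : ∀ {A} → GL A → GL (□ A)

K-valid : ∀ {A B} → Valid (□ (A ⇒ B) ⇒ (□ A ⇒ □ B))
K-valid T = ⇒i λ p → ⇒i λ q → □i T λ u≺T → ⇒e (□e p u≺T) (□e q u≺T)

Löb-valid : ∀ {A} → Valid (□ (□ A ⇒ A) ⇒ □ A)
Löb-valid T = ⇒i λ p → ⊩-stable λ ¬□ →
  let _ , u≺T , ¬A , □A = least-counterexample T ¬□ in ¬A (⇒e (□e p u≺T) □A)

GL-sound : ∀ {A} → GL A → Valid A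
GL-sound (taut t) T = holds (t (val T))
GL-sound axK      T = K-valid T
GL-sound axL      T = Löb-valid T
GL-sound (mp p q) T = ⇒e (GL-sound p T) (GL-sound q T)
GL-sound (nec p)  T = □i T λ {u} _ → GL-sound p u

GL⇒Prf : ∀ {r A} → GL A → Prf r A
GL⇒Prf (taut t) = taut t
GL⇒Prf axK      = axK
GL⇒Prf axL      = axL
GL⇒Prf (mp p q) = mp (GL⇒Prf p) (GL⇒Prf q)
GL⇒Prf (nec p)  = nec (GL⇒Prf p)

GL-prop₀ : ∀ {A} → (∀ V → V ⊩ A) → GL A
GL-prop₀ h = taut λ V → true≡ (h V)

GL-prop₁ : ∀ {A B} → (∀ V → V ⊩ A → V ⊩ B) → GL A → GL B
GL-prop₁ h p = mp (GL-prop₀ λ V → ⇒i (h V)) p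

GL-prop₂ : ∀ {A B C} → (∀ V → V ⊩ A → V ⊩ B → V ⊩ C) → GL A → GL B → GL C
GL-prop₂ h p q = mp (GL-prop₁ (λ V a → ⇒i (h V a)) p) q

GL-⋀ : ∀ L → (∀ {A} → A ∈ L → GL A) → GL (⋀ L)
GL-⋀ []      h = GL-prop₀ λ _ → ⊤i
GL-⋀ (A ∷ L) h = GL-prop₂ (λ _ → ∧i) (h (here refl)) (GL-⋀ L (h ∘ there))

□-mono : ∀ L {B} → GL (⋀ L ⇒ B) → GL (⋀ (map □_ L) ⇒ □ B)
□-mono []      p = GL-prop₁ (λ _ b → ⇒i λ _ → b) (nec (GL-prop₁ (λ _ f → ⇒e f ⊤i) p))
□-mono (A ∷ L) p =
  GL-prop₂ (λ _ f k → ⇒i λ h → ⇒e (⇒e k (⇒e f (∧e₂ h))) (∧e₁ h))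
    (□-mono L (GL-prop₁ (λ _ f → ⇒i λ l → ⇒i λ a → ⇒e f (∧i a l)) p)) axK

□-mono₁ : ∀ {A B} → (∀ V → V ⊩ A → V ⊩ B) → GL (□ A ⇒ □ B)
□-mono₁ {A} h = GL-prop₁ (λ _ f → ⇒i λ a → ⇒e f (∧i a ⊤i))
  (□-mono (A ∷ []) (GL-prop₀ λ V → ⇒i λ a → h V (∧e₁ a)))

-- Löb's axiom applied to A ∧ □A.
□⇒□⊡ : ∀ {A} → GL (□ A ⇒ □ (⊡ A))
□⇒□⊡ {A} = GL-prop₂ (λ _ f l → ⇒i λ a → ⇒e l (⇒e f (∧i a ⊤i))) (□-mono (A ∷ []) A⇒) axL
  where
  A⇒ : GL (⋀ (A ∷ []) ⇒ (□ (⊡ A) ⇒ ⊡ A))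
  A⇒ = GL-prop₁ (λ _ f → ⇒i λ a → ⇒i λ b → ∧i (∧e₁ a) (⇒e f b)) (□-mono₁ λ _ → ∧e₁)

-- Each `□ A` gives `□ (⊡ A)`, so boxing the hypothesis yields `□ (□ B ⇒ B)`, to which Löb's axiom
-- applies.
□-Löb : ∀ L {B} → GL (⋀ (map ⊡_ L) ⇒ (□ B ⇒ B)) → GL (⋀ (map □_ L) ⇒ □ B)
□-Löb L {B} p = GL-prop₂ (λ _ f g → ⇒i λ h → ⇒e g (⇒e f h))
  (GL-prop₂ (λ _ f g → ⇒i λ h → ⇒e f (⇒e g h)) (□-mono (map ⊡_ L) p) (boxes L)) axL
  where
  boxes : ∀ L → GL (⋀ (map □_ L) ⇒ ⋀ (map □_ (map ⊡_ L)))
  boxes []      = GL-prop₀ λ _ → ⇒i λ h → h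
  boxes (A ∷ L) = GL-prop₂ (λ _ f g → ⇒i λ h → ∧i (⇒e f (∧e₁ h)) (⇒e g (∧e₂ h))) □⇒□⊡ (boxes L)

-- Finite choice and enumeration

module _ {X : Set} where

  search : ∀ {P Q : X → Set} L → (∀ {x} → x ∈ L → P x ⊎ Q x) →
           (∀ {x} → x ∈ L → P x) ⊎ Σ X λ x → x ∈ L × Q x
  search []      f = inj₁ λ ()
  search (x ∷ L) f with f (here refl)
  ... | inj₂ q = inj₂ (x , here refl , q)
  ... | inj₁ p with search L (f ∘ there)
  ...   | inj₁ h            = inj₁ λ { (here refl) → p ; (there m) → h m }
  ...   | inj₂ (y , m , q) = inj₂ (y , there m , q)

  -- The last component excludes strays: when the list becomes the children of a tree, each child
  -- must be accounted for.
  choose : ∀ {Y : Set} {P : X → Y → Set} L → (∀ {x} → x ∈ L → Σ Y (P x)) →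
           Σ (List Y) λ M → (∀ {x} → x ∈ L → Σ Y λ y → y ∈ M × P x y)
                          × (∀ {y} → y ∈ M → Σ X λ x → x ∈ L × P x y)
  choose []      f = [] , (λ ()) , λ ()
  choose (x ∷ L) f =
    let y , p = f (here refl) ; M , h , k = choose L (f ∘ there)
    in y ∷ M
     , (λ { (here refl) → y , here refl , p ; (there m) → let z , n , q = h m in z , there n , q })
     , (λ { (here refl) → x , here refl , p ; (there n) → let z , m , q = k n in z , there m , q })

  sublists : List X → List (List X)
  sublists []      = [] ∷ []
  sublists (x ∷ L) = map (x ∷_) (sublists L) ++ sublists L

  filter∈sublists : ∀ {P : X → Set} (P? : Decidable P) L → filter P? L ∈ sublists L
  filter∈sublists P? []      = here refl
  filter∈sublists P? (x ∷ L) with P? x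
  ... | yes _ = ∈-++⁺ˡ (∈-map⁺ (x ∷_) (filter∈sublists P? L))
  ... | no _  = ∈-++⁺ʳ _ (filter∈sublists P? L)

  module _ {P Q : X → Set} (P? : Decidable P) (Q? : Decidable Q) where

    length-filter-≤ : ∀ L → (∀ {x} → x ∈ L → P x → Q x) → length (filter P? L) ≤ length (filter Q? L)
    length-filter-≤ []      h = z≤n
    length-filter-≤ (x ∷ L) h with P? x | Q? x
    ... | yes _ | yes _ = s≤s (length-filter-≤ L (h ∘ there))
    ... | yes p | no ¬q = ⊥-elim (¬q (h (here refl) p))
    ... | no _  | yes _ = m≤n⇒m≤1+n (length-filter-≤ L (h ∘ there))
    ... | no _  | no _  = length-filter-≤ L (h ∘ there)

    length-filter-< : ∀ {y} L → (∀ {x} → x ∈ L → P x → Q x) → y ∈ L → ¬ P y → Q y →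
                      length (filter P? L) < length (filter Q? L)
    length-filter-< (x ∷ L) h (here refl) ¬p q with P? x | Q? x
    ... | yes p | _     = ⊥-elim (¬p p)
    ... | no _  | yes _ = s≤s (length-filter-≤ L (h ∘ there))
    ... | no _  | no ¬q = ⊥-elim (¬q q)
    length-filter-< (x ∷ L) h (there m) ¬p q with P? x | Q? x
    ... | yes _ | yes _ = s≤s (length-filter-< L (h ∘ there) m ¬p q)
    ... | yes p | no ¬q = ⊥-elim (¬q (h (here refl) p))
    ... | no _  | yes _ = m≤n⇒m≤1+n (length-filter-< L (h ∘ there) m ¬p q)
    ... | no _  | no _  = length-filter-< L (h ∘ there) m ¬p q

    -- Meant for a descendant of a node: it has the same true boxes, or at least one more.
    filter-≡-or-new : ∀ L → (∀ {x} → x ∈ L → P x → Q x) →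
                      filter P? L ≡ filter Q? L ⊎ Σ X λ x → x ∈ L × ¬ P x × Q x
    filter-≡-or-new []      h = inj₁ refl
    filter-≡-or-new (x ∷ L) h with P? x | Q? x | filter-≡-or-new L (h ∘ there)
    ... | _     | _     | inj₂ (y , m , r) = inj₂ (y , there m , r)
    ... | yes _ | yes _ | inj₁ e = inj₁ (cong (x ∷_) e)
    ... | yes p | no ¬q | _      = ⊥-elim (¬q (h (here refl) p))
    ... | no ¬p | yes q | _      = inj₂ (x , here refl , ¬p , q)
    ... | no _  | no _  | inj₁ e = inj₁ e

-- Types over a finite set of atoms and a finite set of boxed formulas

-- Boxes are not entered: the truth value has to be a Boolean function of `At` and of the boxes over
-- `Bx`.
Within : List Fm → List Fm → Fm → Set
Within At Bx (var n)  = var n ∈ At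
Within At Bx ⊥'       = ⊤
Within At Bx (¬' A)   = Within At Bx A
Within At Bx (A ∨' B) = Within At Bx A × Within At Bx B
Within At Bx (□ A)    = A ∈ Bx
Within At Bx (■ A)    = ■ A ∈ At

Within-mono : ∀ {At Bx At′ Bx′} A → (∀ {a} → a ∈ At → a ∈ At′) → (∀ {B} → B ∈ Bx → B ∈ Bx′) →
              Within At Bx A → Within At′ Bx′ A
Within-mono (var n)  f g w = f w
Within-mono ⊥'       f g w = tt
Within-mono (¬' A)   f g w = Within-mono A f g w
Within-mono (A ∨' B) f g (w , w′) = Within-mono A f g w , Within-mono B f g w′
Within-mono (□ A)    f g w = g w
Within-mono (■ A)    f g w = f w

atoms : Fm → List Fm
atoms (var n)  = var n ∷ []
atoms ⊥'       = []
atoms (¬' A)   = atoms A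
atoms (A ∨' B) = atoms A ++ atoms B
atoms (□ A)    = atoms A
atoms (■ A)    = ■ A ∷ []

boxed : Fm → List Fm
boxed (var n)  = []
boxed ⊥'       = []
boxed (¬' A)   = boxed A
boxed (A ∨' B) = boxed A ++ boxed B
boxed (□ A)    = A ∷ boxed A
boxed (■ A)    = []

within-self : ∀ A → Within (atoms A) (boxed A) A
within-self (var n)  = here refl
within-self ⊥'       = tt
within-self (¬' A)   = within-self A
within-self (A ∨' B) = Within-mono A ∈-++⁺ˡ ∈-++⁺ˡ (within-self A) ,
                       Within-mono B (∈-++⁺ʳ (atoms A)) (∈-++⁺ʳ (boxed A)) (within-self B)
within-self (□ A)    = here refl
within-self (■ A)    = here refl

within-boxed : ∀ A B → B ∈ boxed A → Within (atoms A) (boxed A) B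
within-boxed (¬' A)   C m = within-boxed A C m
within-boxed (A ∨' B) C m with ∈-++⁻ (boxed A) m
... | inj₁ m′ = Within-mono C ∈-++⁺ˡ ∈-++⁺ˡ (within-boxed A C m′)
... | inj₂ m′ = Within-mono C (∈-++⁺ʳ (atoms A)) (∈-++⁺ʳ (boxed A)) (within-boxed B C m′)
within-boxed (□ A) A (here refl) = Within-mono A (λ m → m) there (within-self A)
within-boxed (□ A) C (there m)   = Within-mono C (λ m → m) there (within-boxed A C m)

module Types (At Bx : List Fm) (closed : ∀ B → B ∈ Bx → Within At Bx B) where

  record Agree (V W : Val) : Set where
    field
      atom≡ : ∀ {n} → var n ∈ At → eval V (var n) ≡ eval W (var n)
      bbox≡ : ∀ {D} → ■ D ∈ At → eval V (■ D) ≡ eval W (■ D)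
      box≡  : ∀ {B} → B ∈ Bx → eval V (□ B) ≡ eval W (□ B)
  open Agree

  agree : ∀ {V W} → Agree V W → ∀ A → Within At Bx A → eval V A ≡ eval W A
  agree α (var n)  w = atom≡ α w
  agree α ⊥'       w = refl
  agree α (¬' A)   w = cong not (agree α A w)
  agree α (A ∨' B) (w , w′) = cong₂ _∨_ (agree α A w) (agree α B w′)
  agree α (□ A)    w = box≡ α w
  agree α (■ A)    w = bbox≡ α w

  -- (true atoms , formulas B with □B true)
  Type : Set
  Type = List Fm × List Fm

  toVal : Type → Val
  toVal (s , X) = record
    { atom = λ n → does (var n ∈? s) ; box = λ B → does (B ∈? X) ; bbox = λ D → does (■ D ∈? s) }

  boxes-of : Val → List Fm
  boxes-of V = filter (λ B → V ⊩? (□ B)) Bx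

  typeOf : Val → Type
  typeOf V = filter (V ⊩?_) At , boxes-of V

  does-∈-filter : ∀ {P : Fm → Set} (P? : Decidable P) {V A} {x} L → x ∈ L →
                  (P x → V ⊩ A) → (V ⊩ A → P x) → does (x ∈? filter P? L) ≡ eval V A
  does-∈-filter P? {V} {A} L m f g with V ⊩? A
  ... | yes p = trans (dec-true (_ ∈? _) (∈-filter⁺ P? m (g p))) (sym (true≡ p))
  ... | no ¬p = trans (dec-false (_ ∈? _) (λ k → ¬p (f (proj₂ (∈-filter⁻ P? {xs = L} k))))) (sym (⊮⇒false ¬p))

  typeOf-agree : ∀ V → Agree (toVal (typeOf V)) V
  typeOf-agree V = record
    { atom≡ = λ m → does-∈-filter (V ⊩?_) At m (λ p → p) (λ p → p)
    ; bbox≡ = λ m → does-∈-filter (V ⊩?_) At m (λ p → p) (λ p → p)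
    ; box≡  = λ m → does-∈-filter (λ B → V ⊩? (□ B)) Bx m (λ p → p) (λ p → p) }

  types : List Type
  types = cartesianProduct (sublists At) (sublists Bx)

  typeOf∈types : ∀ V → typeOf V ∈ types
  typeOf∈types V = ∈-cartesianProduct⁺ (filter∈sublists _ At) (filter∈sublists _ Bx)

  ∈boxes-of⁺ : ∀ {V B} → B ∈ Bx → V ⊩ □ B → B ∈ boxes-of V
  ∈boxes-of⁺ {V} m p = ∈-filter⁺ (λ B → V ⊩? (□ B)) m p

  ∈boxes-of⁻ : ∀ {V B} → B ∈ boxes-of V → V ⊩ □ B
  ∈boxes-of⁻ {V} m = proj₂ (∈-filter⁻ (λ B → V ⊩? (□ B)) {xs = Bx} m)

  -- The canonical accessibility relation of K4, cut down to `Bx`. What GL demands beyond it comes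
  -- from `Candidate`.
  Compat : List Fm → Type → Set
  Compat X σ = All (λ B → B ∈ X → toVal σ ⊩ B × B ∈ proj₂ σ) Bx

  compat? : ∀ X → Decidable (Compat X)
  compat? X σ = all? (λ B → (B ∈? X) →-dec ((toVal σ ⊩? B) ×-dec (B ∈? proj₂ σ))) Bx

  succs : List Fm → List Type
  succs X = filter (compat? X) types

  compat-typeOf : ∀ {X V} → (∀ {B} → B ∈ Bx → B ∈ X → V ⊩ B × V ⊩ □ B) → Compat X (typeOf V)
  compat-typeOf {X} {V} h = All-tabulate λ {B} m k →
    let p , q = h m k in ⊩-cong (sym (agree (typeOf-agree V) B (closed _ m))) p , ∈boxes-of⁺ m q

  typeOf∈succs : ∀ {X V} → (∀ {B} → B ∈ Bx → B ∈ X → V ⊩ B × V ⊩ □ B) → typeOf V ∈ succs X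
  typeOf∈succs {X} {V} h = ∈-filter⁺ (compat? X) (typeOf∈types V) (compat-typeOf h)

  succs-compat : ∀ {X σ} → σ ∈ succs X → Compat X σ
  succs-compat {X} m = proj₂ (∈-filter⁻ (compat? X) {xs = types} m)

  missing : List Fm → ℕ
  missing X = length (filter (λ B → ¬? (B ∈? X)) Bx)

  missing-< : ∀ X Y {B} → (∀ {C} → C ∈ Bx → C ∈ X → C ∈ Y) → B ∈ Bx → B ∉ X → B ∈ Y → missing Y < missing X
  missing-< X Y h m ∉X ∈Y = length-filter-< _ _ Bx (λ m n k → n (h m k)) m (λ n → n ∈Y) ∉X

  -- Refuting a type in GL or realizing it by a tree

  Realizes : Tree → Type → Set
  Realizes T τ = Agree (val T) (toVal τ)

  realizes-⊩ : ∀ T τ {A} → Realizes T τ → A ∈ Bx → toVal τ ⊩ A → val T ⊩ A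
  realizes-⊩ T τ {A} ρ m = ⊩-cong (sym (agree ρ A (closed A m)))

  realizes-⊮ : ∀ T τ {A} → Realizes T τ → A ∈ Bx → ¬ (toVal τ ⊩ A) → ¬ (val T ⊩ A)
  realizes-⊮ T τ {A} ρ m h p = h (⊩-cong (agree ρ A (closed A m)) p)

  ∈⇒⊩□ : ∀ τ {B} → B ∈ proj₂ τ → toVal τ ⊩ □ B
  ∈⇒⊩□ _ m = holds (dec-true (_ ∈? _) m)

  realizes-boxes : ∀ X {ts} →
    (∀ {t} → t ∈ ts → Σ Type λ σ → Compat X σ × Realizes t σ) →
    (∀ {B} → B ∈ Bx → B ∉ X → Σ Tree λ t → t ∈ ts × ¬ (val t ⊩ B)) →
    ∀ {B} → B ∈ Bx → allBelow ts B ≡ does (B ∈? X)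
  realizes-boxes X {ts} h k {B} m with B ∈? X
  ... | yes p = allBelow⁺ ts λ {t} n →
        let σ , l , ρ = h n ; q , q′ = All-lookup l m p
        in realizes-⊩ t σ ρ m q , ⊩-cong (sym (box≡ ρ m)) (∈⇒⊩□ σ q′)
  ... | no ¬p with allBelow ts B in eq
  ...   | false = refl
  ...   | true  = let t , n , ¬B = k m ¬p in ⊥-elim (¬B (proj₁ (allBelow⁻ ts eq n)))

  lit : Bool → Fm → Fm
  lit true  A = A
  lit false A = ¬' A

  ⊩lit : ∀ {V} A → V ⊩ lit (eval V A) A
  ⊩lit {V} A with eval V A in eq
  ... | true  = holds eq
  ... | false = ¬i λ (holds p) → case trans (sym eq) p of λ ()

  ⊩lit⁻ : ∀ {V A} c → V ⊩ lit c A → eval V A ≡ c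
  ⊩lit⁻ true  p = true≡ p
  ⊩lit⁻ false p = ⊮⇒false (¬e p)

  -- Only boxes are recorded: the atoms at a root can be set freely, so realizability of a type
  -- depends on its true boxes alone.
  χ : List Fm → Fm
  χ X = ⋀ (map (λ B → lit (does (B ∈? X)) (□ B)) Bx)

  ⊩χ : ∀ V → V ⊩ χ (boxes-of V)
  ⊩χ V = ⋀i-map _ Bx λ {B} m → subst (λ c → V ⊩ lit c (□ B)) (sym (box≡ (typeOf-agree V) m)) (⊩lit (□ B))

  χ-box : ∀ {V} X {B} → V ⊩ χ X → B ∈ Bx → eval V (□ B) ≡ does (B ∈? X)
  χ-box X c m = ⊩lit⁻ _ (⋀e-map _ c m)

  -- The type of a least counterexample to `B`. Its true `□ B` makes the number of false boxes drop.
  Candidate : Fm → Type → Set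
  Candidate B σ = ¬ (toVal σ ⊩ B) × B ∈ proj₂ σ

  candidate? : ∀ B → Decidable (Candidate B)
  candidate? B σ = ¬? (toVal σ ⊩? B) ×-dec (B ∈? proj₂ σ)

  candidates : List Fm → Fm → List Type
  candidates X B = filter (candidate? B) (succs X)

  candidates⁻ : ∀ X B {σ} → σ ∈ candidates X B → Compat X σ × Candidate B σ
  candidates⁻ X B m = let p , q = ∈-filter⁻ (candidate? B) {xs = succs X} m in succs-compat p , q

  -- Under `⊡` of all members of `X` in `Bx`, a valuation with `□ B` true and `B` false would have a
  -- candidate as its type, and those are refuted. So `□ B ⇒ B` follows, and `□-Löb` gives the `□ B`
  -- that `χ X` denies.
  refute : ∀ X {B} → B ∈ Bx → B ∉ X → (∀ {σ} → σ ∈ candidates X B → GL (¬' χ (proj₂ σ))) → GL (¬' χ X)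
  refute X {B} m ∉X h = GL-prop₁ (λ V f → ¬i λ c →
      case trans (sym (true≡ (⇒e f (⋀i-map □_ L λ k →
             let k₁ , k₂ = ∈-filter⁻ (_∈? X) {xs = Bx} k
             in holds (trans (χ-box X c k₁) (dec-true (_ ∈? X) k₂))))))
           (trans (χ-box X c m) (dec-false (B ∈? X) ∉X)) of λ ())
    (□-Löb L (GL-prop₁ ⊡L⇒ (GL-⋀ _ λ k → case ∈-map⁻ (λ σ → ¬' χ (proj₂ σ)) k of λ { (_ , k′ , refl) → h k′ })))
    where
    L = filter (_∈? X) Bx
    ⊡L⇒ : ∀ V → V ⊩ ⋀ (map (λ σ → ¬' χ (proj₂ σ)) (candidates X B)) → V ⊩ ⋀ (map ⊡_ L) ⇒ (□ B ⇒ B)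
    ⊡L⇒ V nχ = ⇒i λ l → ⇒i λ b → ⊩-stable λ ¬B →
      ¬e (⋀e-map _ nχ (∈-filter⁺ (candidate? B)
            (typeOf∈succs λ k k′ → let p = ⋀e-map ⊡_ l (∈-filter⁺ (_∈? X) k k′) in ∧e₁ p , ∧e₂ p)
            ((λ p → ¬B (⊩-cong (agree (typeOf-agree V) B (closed B m)) p)) , ∈boxes-of⁺ m b)))
         (⊩χ V)

  -- Induction on the number of false boxes. If every false box has a realized candidate, these
  -- trees become the children of a new root; otherwise all candidates of some false box are
  -- refuted.
  refuted-or-realized : ∀ n τ → missing (proj₂ τ) < n →
                        GL (¬' χ (proj₂ τ)) ⊎ Σ Tree λ T → Realizes T τ
  refuted-or-realized (suc n) (s , X) (s≤s lt) with search false-boxes step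
    where
    false-boxes = filter (λ B → ¬? (B ∈? X)) Bx
    step : ∀ {B} → B ∈ false-boxes →
      (Σ Tree λ t → ¬ (val t ⊩ B) × Σ Type λ σ → Compat X σ × Realizes t σ)
      ⊎ (∀ {σ} → σ ∈ candidates X B → GL (¬' χ (proj₂ σ)))
    step {B} m with ∈-filter⁻ (λ B → ¬? (B ∈? X)) {xs = Bx} m
    ... | m∈ , m∉ with search (candidates X B) (λ {σ} k →
            let c , _ , B∈ = candidates⁻ X B k
            in refuted-or-realized n σ (≤-trans (missing-< X (proj₂ σ) (λ p q → proj₂ (All-lookup c p q)) m∈ m∉ B∈) lt))
    ...   | inj₁ all           = inj₂ all
    ...   | inj₂ (σ , k , T , ρ) =
            let c , ¬B , _ = candidates⁻ X B k in inj₁ (T , realizes-⊮ T σ ρ m∈ ¬B , σ , c , ρ)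
  ... | inj₂ (B , m , h) = let p , q = ∈-filter⁻ (λ B → ¬? (B ∈? X)) {xs = Bx} m in inj₁ (refute X p q h)
  ... | inj₁ h = let ts , f , g = choose _ h in
        inj₂ (node (λ n → does (var n ∈? s)) (λ D → does (■ D ∈? s)) ts , record
          { atom≡ = λ _ → refl ; bbox≡ = λ _ → refl
          ; box≡ = realizes-boxes X (λ k → let _ , _ , _ , r = g k in r)
                     λ m ∉X → let t , k , ¬B , _ = f (∈-filter⁺ (λ B → ¬? (B ∈? X)) m ∉X) in t , k , ¬B })

-- Decidability and completeness of GL

abstract
  -- A valuation satisfies the `χ` of its own type, so once every type falsifying `A` has a refuted
  -- `χ`, `A` follows. Opacity keeps `link`, which branches on the result, from unfolding the
  -- search.
  GL-decide : ∀ A → GL A ⊎ Σ Tree λ T → ¬ (val T ⊩ A)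
  GL-decide A = case search (filter fails? types) (λ {τ} _ → refuted-or-realized _ τ ≤-refl) of λ
    { (inj₂ (τ , m , T , ρ)) → inj₂ (T , λ p →
        proj₂ (∈-filter⁻ fails? {xs = types} m) (⊩-cong (agree ρ A (within-self A)) p))
    ; (inj₁ h) → inj₁ (GL-prop₁
        (λ V nχ → ⊩-stable λ ¬A → ¬e (⋀e-map _ nχ (∈-filter⁺ fails? (typeOf∈types V)
           λ p → ¬A (⊩-cong (agree (typeOf-agree V) A (within-self A)) p))) (⊩χ V))
        (GL-⋀ _ λ k → case ∈-map⁻ (λ τ → ¬' χ (proj₂ τ)) k of λ { (_ , k′ , refl) → h k′ })) }
    where
    open Types (atoms A) (boxed A) (within-boxed A)
    fails? : Decidable (λ τ → ¬ (toVal τ ⊩ A))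
    fails? τ = ¬? (toVal τ ⊩? A)

GL-complete : ∀ {A} → Valid A → GL A
GL-complete {A} v with GL-decide A
... | inj₁ p        = p
... | inj₂ (T , ¬A) = ⊥-elim (¬A (v T))

-- Uniform interpolation for GL

Over : (Fm → Set) → Fm → Set
Over Q (var n)  = Q (var n)
Over Q ⊥'       = ⊤
Over Q (¬' A)   = Over Q A
Over Q (A ∨' B) = Over Q A × Over Q B
Over Q (□ A)    = Over Q A
Over Q (■ A)    = Q (■ A)

Over-⋁ : ∀ {X : Set} {Q} (f : X → Fm) L → (∀ {x} → x ∈ L → Over Q (f x)) → Over Q (⋁ (map f L))
Over-⋁ f []      h = tt
Over-⋁ f (x ∷ L) h = h (here refl) , Over-⋁ f L (h ∘ there)

Over-⋀ : ∀ {X : Set} {Q} (f : X → Fm) L → (∀ {x} → x ∈ L → Over Q (f x)) → Over Q (⋀ (map f L))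
Over-⋀ f []      h = tt
Over-⋀ f (x ∷ L) h = h (here refl) , Over-⋀ f L (h ∘ there)

Over-atom : ∀ {Q a} A → a ∈ atoms A → Q a → Over Q a
Over-atom (var n)  (here refl) q = q
Over-atom (¬' A)   m q = Over-atom A m q
Over-atom (A ∨' B) m q = [ (λ k → Over-atom A k q) , (λ k → Over-atom B k q) ]′ (∈-++⁻ (atoms A) m)
Over-atom (□ A)    m q = Over-atom A m q
Over-atom (■ A)    (here refl) q = q

tree-ind : (P : Tree → Set) → (∀ T → (∀ {t} → t ∈ children T → P t) → P T) → ∀ T → P T
tree-ind P f (node a b ts) = f _ (go ts)
  where
  go : ∀ ts {t} → t ∈ ts → P t
  go (t ∷ ts) (here refl) = tree-ind P f t
  go (t ∷ ts) (there m)   = go ts m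

module Quantifier (At Bx : List Fm) (closed : ∀ B → B ∈ Bx → Within At Bx B)
                  {Keep : Fm → Set} (keep? : Decidable Keep) where
  open Types At Bx closed
  open Agree

  at : List Fm → Fm
  at s = ⋀ (map (λ a → lit (does (a ∈? s)) a) (filter keep? At))

  -- φ n (s , X) says that some tree agreeing with the present one on all formulas over
  -- kept atoms has type (s , X), provided n exceeds the number of false boxes of X.
  -- A proper descendant either makes more boxes true (moreBoxes) or has the same
  -- true boxes X, in which case only its atoms and its witnesses matter.
  φ : ℕ → Type → Fm
  moreBoxes witnesses : ℕ → List Fm → Fm
  sameBoxes : List Fm → Fm

  φ zero    _       = ⊥'
  φ (suc n) (s , X) = at s ∧' witnesses n X ∧' □ (moreBoxes n X ∨' (sameBoxes X ∧' witnesses n X))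

  moreBoxes n X = ⋁ (map (φ n) (succs X))

  sameBoxes X = ⋁ (map at (filter (λ s → compat? X (s , X)) (sublists At)))

  witnesses n X = ⋀ (map (λ B → ◇ ⋁ (map (φ n) (filter (λ σ → ¬? (toVal σ ⊩? B)) (succs X))))
                         (filter (λ B → ¬? (B ∈? X)) Bx))

  ⊩at : ∀ V → V ⊩ at (proj₁ (typeOf V))
  ⊩at V = ⋀i-map _ (filter keep? At) λ {a} m → subst (λ c → V ⊩ lit c a)
    (sym (does-∈-filter (V ⊩?_) At (proj₁ (∈-filter⁻ keep? {xs = At} m)) (λ p → p) (λ p → p))) (⊩lit a)

  compat-below : ∀ {T u} → u ≺ T → ∀ {B} → B ∈ Bx → B ∈ boxes-of (val T) → val u ⊩ B × val u ⊩ □ B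
  compat-below {T} u≺T _ k = let p = ∈boxes-of⁻ {val T} k in □e p u≺T , □-trans p u≺T

  missing-below : ∀ {T u B} → u ≺ T → B ∈ Bx → ¬ (val T ⊩ □ B) → val u ⊩ □ B →
                  missing (boxes-of (val u)) < missing (boxes-of (val T))
  missing-below {T} {u} u≺T m ¬p q =
    missing-< (boxes-of (val T)) (boxes-of (val u)) (λ k l → ∈boxes-of⁺ {val u} k (□-trans (∈boxes-of⁻ {val T} l) u≺T)) m
      (λ l → ¬p (∈boxes-of⁻ {val T} l)) (∈boxes-of⁺ {val u} m q)

  -- A least counterexample has fewer false boxes than `T`, so index `n` is enough for the witnesses
  -- even when `T` is only bounded by `suc n`.
  ⊩φ : ∀ n T → missing (boxes-of (val T)) < n → val T ⊩ φ n (typeOf (val T))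
  ⊩witnesses : ∀ n T → missing (boxes-of (val T)) < suc n → val T ⊩ witnesses n (boxes-of (val T))

  ⊩witnesses n T (s≤s lt) = ⋀i-map _ (filter (λ B → ¬? (B ∈? X)) Bx) λ {B} m →
    let m∈ , m∉ = ∈-filter⁻ (λ B → ¬? (B ∈? X)) {xs = Bx} m
        ¬□B = λ p → m∉ (∈boxes-of⁺ {val T} m∈ p)
        u , u≺T , ¬B , □B = least-counterexample T ¬□B
    in ◇i u≺T (⋁i-map (φ n)
         (∈-filter⁺ (λ σ → ¬? (toVal σ ⊩? B)) (typeOf∈succs (compat-below u≺T))
            λ p → ¬B (⊩-cong (agree (typeOf-agree (val u)) B (closed B m∈)) p))
         (⊩φ n u (≤-trans (missing-below u≺T m∈ ¬□B □B) lt)))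
    where X = boxes-of (val T)

  ⊩φ (suc n) T (s≤s lt) = ∧i (⊩at (val T)) (∧i (⊩witnesses n T (s≤s lt)) (□i T λ {u} u≺T →
    -- With the same true boxes, `u` satisfies the same `witnesses n X`; a new true box leaves fewer
    -- false ones and allows `φ n`.
    case filter-≡-or-new (λ B → val T ⊩? (□ B)) (λ B → val u ⊩? (□ B)) Bx (λ _ p → □-trans p u≺T) of λ
      { (inj₁ e) → ∨i₂ (∧i
          (⋁i-map at (∈-filter⁺ (λ s → compat? X (s , X)) (filter∈sublists _ At)
             (subst (λ Y → Compat X (proj₁ (typeOf (val u)) , Y)) (sym e) (compat-typeOf (compat-below u≺T))))
             (⊩at (val u)))
          (subst (λ Y → val u ⊩ witnesses n Y) (sym e)
             (⊩witnesses n u (subst (λ Y → missing Y < suc n) e (s≤s lt)))))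
      ; (inj₂ (B , m , ¬p , q)) → ∨i₁ (⋁i-map (φ n) (typeOf∈succs (compat-below u≺T))
          (⊩φ n u (≤-trans (missing-below u≺T m ¬p q) lt))) }))
    where X = boxes-of (val T)

  -- Copies of a tree with a prescribed type

  infix 4 _~_
  _~_ : Tree → Tree → Set
  T ~ U = ∀ G → Over Keep G → eval (val T) G ≡ eval (val U) G

  -- Atoms at the root of a copy: kept ones are inherited from the tree, the others are dictated by
  -- the type.
  mix : Fm → List Fm → Bool → Bool
  mix a s c = if does (keep? a) then c else does (a ∈? s)

  mix-keep : ∀ a s {c} → Keep a → mix a s c ≡ c
  mix-keep a s k rewrite dec-true (keep? a) k = refl

  mix-at : ∀ V a s → V ⊩ at s → a ∈ At → mix a s (eval V a) ≡ does (a ∈? s)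
  mix-at V a s p m with keep? a
  ... | yes k = ⊩lit⁻ _ (⋀e-map _ p (∈-filter⁺ keep? m k))
  ... | no _  = refl

  Typed : List Fm → Tree → Set
  Typed X t = Σ Type λ σ → Compat X σ × Realizes t σ

  Copy : Tree → Tree → Set
  Copy T t = Σ Tree λ v → v ≺ T × t ~ v

  -- Back and forth conditions of a bisimulation. A new child may copy any proper descendant,
  -- because `□` looks at all of them.
  assemble : ∀ T s X ts → val T ⊩ at s →
    (∀ {t} → t ∈ ts → Copy T t × Typed X t) →
    (∀ {v} → v ∈ children T → Σ Tree λ t → t ∈ ts × t ~ v) →
    (∀ {B} → B ∈ Bx → B ∉ X → Σ Tree λ t → t ∈ ts × ¬ (val t ⊩ B)) →
    Σ Tree λ T′ → T′ ~ T × Realizes T′ (s , X)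
  assemble T@(node a b us) s X ts p copy cover fail = T′ , same , record
    { atom≡ = λ {n} → mix-at (val T) (var n) s p ; bbox≡ = λ {D} → mix-at (val T) (■ D) s p
    ; box≡ = realizes-boxes X (λ k → proj₂ (copy k)) fail }
    where
    T′ = node (λ n → mix (var n) s (a n)) (λ D → mix (■ D) s (b D)) ts

    same : T′ ~ T
    same (var n)  o = mix-keep (var n) s o
    same ⊥'       o = refl
    same (¬' G)   o = cong not (same G o)
    same (G ∨' H) (o , o′) = cong₂ _∨_ (same G o) (same H o′)
    same (■ D)    o = mix-keep (■ D) s o
    same (□ G)    o = eval-ext {val T′} {val T} {□ G} {□ G}
      (λ r → □i-children T λ m → let t , k , e = cover m ; x , y = □e-children T′ r k
                                 in ⊩-cong (e G o) x , ⊩-cong (e (□ G) o) y)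
      (λ r → □i-children T′ λ m → let v , v≺T , e = proj₁ (copy m)
                                  in ⊩-cong (sym (e G o)) (□e r v≺T) , ⊩-cong (sym (e (□ G) o)) (□-trans r v≺T))

  moreBoxes⁻ : ∀ {V} n X → V ⊩ moreBoxes n X → Σ Type λ σ → Compat X σ × V ⊩ φ n σ
  moreBoxes⁻ n X h with ⋁e-map (φ n) (succs X) h
  ... | σ , m , p = σ , succs-compat m , p

  sameBoxes⁻ : ∀ {V} X → V ⊩ sameBoxes X → Σ (List Fm) λ s → Compat X (s , X) × V ⊩ at s
  sameBoxes⁻ X h with ⋁e-map at (filter (λ s → compat? X (s , X)) (sublists At)) h
  ... | s , m , p = s , proj₂ (∈-filter⁻ (λ s → compat? X (s , X)) {xs = sublists At} m) , p

  witnesses⁻ : ∀ n X T {B} → val T ⊩ witnesses n X → B ∈ filter (λ B → ¬? (B ∈? X)) Bx →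
               Σ Tree λ v → v ≺ T × Σ Type λ σ → Compat X σ × ¬ (toVal σ ⊩ B) × val v ⊩ φ n σ
  witnesses⁻ n X T {B} w m with ◇e T (⋀e-map _ w m)
  ... | v , v≺T , r with ⋁e-map (φ n) (filter (λ σ → ¬? (toVal σ ⊩? B)) (succs X)) r
  ... | σ , k , p with ∈-filter⁻ (λ σ → ¬? (toVal σ ⊩? B)) {xs = succs X} k
  ... | k₁ , k₂ = v , v≺T , σ , succs-compat k₁ , k₂ , p

  -- Two nested inductions: the outer one on `n`, entering as `realizeₙ`, handles `moreBoxes` and
  -- the witnesses; the inner one on the tree handles descendants that keep the boxes `X`.
  module Build (n : ℕ) (X : List Fm)
    (realizeₙ : ∀ T σ → val T ⊩ φ n σ → Σ Tree λ T′ → T′ ~ T × Realizes T′ σ) where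

    θ : Fm
    θ = moreBoxes n X ∨' (sameBoxes X ∧' witnesses n X)

    Buildable : Tree → Set
    Buildable T = ∀ s → val T ⊩ at s → val T ⊩ witnesses n X → val T ⊩ □ θ →
                  Σ Tree λ T′ → T′ ~ T × Realizes T′ (s , X)

    copy : ∀ v → Buildable v → val v ⊩ θ → val v ⊩ □ θ → Σ Tree λ t → t ~ v × Typed X t
    copy v ih q q′ = case ∨e q of λ
      { (inj₁ r) → case moreBoxes⁻ n X r of λ { (σ , c , r′) →
          case realizeₙ v σ r′ of λ { (t , e , ρ) → t , e , σ , c , ρ } }
      ; (inj₂ r) → case sameBoxes⁻ X (∧e₁ r) of λ { (s , c , r′) →
          case ih s r′ (∧e₂ r) q′ of λ { (t , e , ρ) → t , e , (s , X) , c , ρ } } }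

    Witness : Tree → Fm → Tree → Set
    Witness T B t = Copy T t × ¬ (val t ⊩ B) × Typed X t

    witness : ∀ T {B} → val T ⊩ witnesses n X → B ∈ filter (λ B → ¬? (B ∈? X)) Bx → Σ Tree (Witness T B)
    witness T w m = case witnesses⁻ n X T w m of λ { (v , v≺T , σ , c , ¬B , r) →
      case realizeₙ v σ r of λ { (t , e , ρ) →
        t , (v , v≺T , e) , realizes-⊮ t σ ρ (proj₁ (∈-filter⁻ (λ B → ¬? (B ∈? X)) {xs = Bx} m)) ¬B , σ , c , ρ } }

    -- Copies of the children of `T` give the forth condition; copies of the witnesses falsify the
    -- boxes outside `X`.
    build : ∀ T → (∀ {t} → t ∈ children T → Buildable t) → Buildable T
    build T ih s p w q =
      case choose {P = λ v t → t ~ v × Typed X t} (children T)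
             (λ {v} m → copy v (ih m) (proj₁ (□e-children T q m)) (proj₂ (□e-children T q m))) of λ { (ts₁ , f₁ , g₁) →
      case choose {P = Witness T} (filter (λ B → ¬? (B ∈? X)) Bx) (witness T w) of λ { (ts₂ , f₂ , g₂) →
      assemble T s X (ts₁ ++ ts₂) p
        (λ m → case ∈-++⁻ ts₁ m of λ
           { (inj₁ k) → case g₁ k of λ { (v , l , e , r) → (v , child l , e) , r }
           ; (inj₂ k) → case g₂ k of λ { (_ , _ , c , _ , r) → c , r } })
        (λ m → case f₁ m of λ { (t , k , e , _) → t , ∈-++⁺ˡ k , e })
        (λ m ∉X → case f₂ (∈-filter⁺ (λ B → ¬? (B ∈? X)) m ∉X) of λ
           { (t , k , _ , ¬B , _) → t , ∈-++⁺ʳ ts₁ k , ¬B }) } }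

  realize : ∀ n T τ → val T ⊩ φ n τ → Σ Tree λ T′ → T′ ~ T × Realizes T′ τ
  realize zero    T τ       h = ⊥-elim (⊥e h)
  realize (suc n) T (s , X) h = tree-ind Buildable build T s (∧e₁ h) (∧e₁ (∧e₂ h)) (∧e₂ (∧e₂ h))
    where open Build n X (realize n)

  module _ {Q : Fm → Set} (atomic : ∀ {a} → a ∈ At → Keep a → Over Q a) where

    Over-lit : ∀ A c → Over Q A → Over Q (lit c A)
    Over-lit A true  o = o
    Over-lit A false o = o

    Over-at : ∀ s → Over Q (at s)
    Over-at s = Over-⋀ _ (filter keep? At) λ {a} m →
      let k , l = ∈-filter⁻ keep? {xs = At} m in Over-lit a (does (a ∈? s)) (atomic k l)

    Over-φ : ∀ n τ → Over Q (φ n τ)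
    Over-φ zero    _       = tt
    Over-φ (suc n) (s , X) = Over-at s , w ,
        Over-⋁ (φ n) (succs X) (λ {σ} _ → Over-φ n σ) ,
        Over-⋁ at (filter (λ s → compat? X (s , X)) (sublists At)) (λ {s} _ → Over-at s) , w
      where
      w : Over Q (witnesses n X)
      w = Over-⋀ _ (filter (λ B → ¬? (B ∈? X)) Bx) λ {B} _ →
        Over-⋁ (φ n) (filter (λ σ → ¬? (toVal σ ⊩? B)) (succs X)) λ {σ} _ → Over-φ n σ

-- `C` is the disjunction of `φ N τ` over the types satisfying `A`. A tree with `C` has a copy with
-- `A`, hence with `G`, and formulas over kept atoms cannot tell the two apart.
GL-uniform-interpolation : ∀ A {Keep : Fm → Set} → Decidable Keep → Σ Fm λ C →
  Over (λ a → a ∈ atoms A × Keep a) C × Valid (A ⇒ C) ×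
  (∀ G → Over Keep G → Valid (A ⇒ G) → Valid (C ⇒ G))
GL-uniform-interpolation A {Keep} keep? =
    ⋁ (map (φ N) good)
  , Over-⋁ (φ N) good (λ {τ} _ → Over-φ (λ m k → Over-atom A m (m , k)) N τ)
  , (λ T → ⇒i λ p → ⋁i-map (φ N)
       (∈-filter⁺ sat? (typeOf∈types (val T)) (⊩-cong (sym (agree (typeOf-agree (val T)) A (within-self A))) p))
       (⊩φ N T (s≤s (length-filter (λ B → ¬? (B ∈? boxes-of (val T))) (boxed A)))))
  , (λ G o h T → ⇒i λ c →
       let τ , m , p = ⋁e-map (φ N) good c
           T′ , e , ρ = realize N T τ p
           q = ⊩-cong (sym (agree ρ A (within-self A))) (proj₂ (∈-filter⁻ sat? {xs = types} m))
       in ⊩-cong (e G o) (⇒e (h T′) q))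
  where
  open Types (atoms A) (boxed A) (within-boxed A)
  open Quantifier (atoms A) (boxed A) (within-boxed A) keep?
  -- Exceeds the number of false boxes of every type.
  N = suc (length (boxed A))
  sat? = λ τ → toVal τ ⊩? A
  good = filter sat? types

-- Finite tree models of GR

tr : Fm → Fm
tr (var n)  = var n
tr ⊥'       = ⊥'
tr (¬' A)   = ¬' tr A
tr (A ∨' B) = tr A ∨' tr B
tr (□ A)    = □ tr A
tr (■ A)    = ((¬' (□ ⊥')) ∧' □ tr A) ∨' (□ ⊥' ∧' ■ A)

-- Takes an arbitrary disjunction, so that proofs can generalise over the opaque `GL-decide`.
whenLeft : {P Q : Set} → P ⊎ Q → Fm → Fm
whenLeft (inj₁ _) A = A
whenLeft (inj₂ _) A = ⊤'

-- Y holds at every terminal node above a node with □X. The second conjunct is what the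
-- rule □A / A adds: a terminal root must satisfy Y as soon as X is a theorem.
link : Fm → Fm → Fm → Fm
link Θ X Y = (⊡ (□ X ⇒ □ (□ ⊥' ⇒ Y))) ∧' whenLeft (GL-decide (Θ ⇒ X)) (□ ⊥' ⇒ Y)

axioms : Fm → Fm → Fm
axioms Θ D = link Θ (tr D) (■ D) ∧' link Θ (¬' tr D) (¬' ■ D)

-- The premise `Θ` for `■ A` concerns only the ■-subformulas of `A`, so the recursion is structural.
theory : Fm → Fm
theory (var n)  = ⊤'
theory ⊥'       = ⊤'
theory (¬' A)   = theory A
theory (A ∨' B) = theory A ∧' theory B
theory (□ A)    = theory A
theory (■ A)    = theory A ∧' axioms (theory A) A

module _ {Θ X Y : Fm} where

  link-i : ∀ T → (val T ⊩ □ X → val T ⊩ □ (□ ⊥' ⇒ Y)) →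
           (∀ {u} → u ≺ T → val u ⊩ □ X → val u ⊩ □ (□ ⊥' ⇒ Y)) →
           (GL (Θ ⇒ X) → val T ⊩ □ ⊥' ⇒ Y) → val T ⊩ link Θ X Y
  link-i T f g h = ∧i (∧i (⇒i f) (□i T λ u≺T → ⇒i (g u≺T))) (left (GL-decide (Θ ⇒ X)))
    where
    left : {Q : Set} (d : GL (Θ ⇒ X) ⊎ Q) → val T ⊩ whenLeft d (□ ⊥' ⇒ Y)
    left (inj₁ p) = h p
    left (inj₂ _) = ⊤i

  link-here : ∀ {V} → V ⊩ link Θ X Y → V ⊩ □ X → V ⊩ □ (□ ⊥' ⇒ Y)
  link-here h = ⇒e (∧e₁ (∧e₁ h))

  link-above : ∀ {T u} → val T ⊩ link Θ X Y → u ≺ T → val u ⊩ □ X → val u ⊩ □ (□ ⊥' ⇒ Y)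
  link-above h u≺T = ⇒e (□e (∧e₂ (∧e₁ h)) u≺T)

  link-left : ∀ {V} → V ⊩ link Θ X Y → GL (Θ ⇒ X) → V ⊩ □ ⊥' ⇒ Y
  link-left {V} h p = left (GL-decide (Θ ⇒ X)) (∧e₂ h)
    where
    left : (d : GL (Θ ⇒ X) ⊎ Σ Tree λ T → ¬ (val T ⊩ Θ ⇒ X)) → V ⊩ whenLeft d (□ ⊥' ⇒ Y) → V ⊩ □ ⊥' ⇒ Y
    left (inj₁ _)       k = k
    left (inj₂ (T , c)) k = ⊥-elim (c (GL-sound p T))

  -- If `Θ` proves `X`, then `□ X` holds at `T` since `Θ` holds everywhere below, and the link at
  -- `T` already forces `Y` at a terminal `u`.
  link-below : ∀ T {u} → val T ⊩ link Θ X Y → (∀ {u} → u ≺ T → val u ⊩ Θ) → u ≺ T → val u ⊩ link Θ X Y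
  link-below T {u} h θ u≺T = link-i u (link-above h u≺T) (λ v≺u → link-above h (≺-trans v≺u u≺T))
    λ p → □e (link-here h (□i T λ {v} v≺T → ⇒e (GL-sound p v) (θ v≺T))) u≺T

  -- If `□ X` holds at the root, `X` holds at `t` and is therefore derivable from `Θ`, so each
  -- terminal child satisfies `Y` by its own link. The root has a child, so it is not terminal
  -- itself.
  link-root : ∀ T {t} → (∀ {t} → t ∈ children T → val t ⊩ link Θ X Y) →
              t ∈ children T → (val t ⊩ X → GL (Θ ⇒ X)) → val T ⊩ link Θ X Y
  link-root T h m g = link-i T
    (λ □X → □i-children T λ k → link-left (h k) (g (proj₁ (□e-children T □X m))) , link-here (h k) (proj₂ (□e-children T □X k)))
    (λ { (child k) → link-here (h k) ; (below v≺t k) → link-above (h k) v≺t })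
    (λ _ → ⇒i λ □⊥ → ⊥-elim (⊥e (proj₁ (□e-children T □⊥ m))))

theory-below : ∀ A T → val T ⊩ theory A → ∀ {u} → u ≺ T → val u ⊩ theory A
theory-below (var n)  T h _ = ⊤i
theory-below ⊥'       T h _ = ⊤i
theory-below (¬' A)   T h   = theory-below A T h
theory-below (A ∨' B) T h p = ∧i (theory-below A T (∧e₁ h) p) (theory-below B T (∧e₂ h) p)
theory-below (□ A)    T h   = theory-below A T h
theory-below (■ A)    T h p = ∧i (θ p) (∧i (link-below T (∧e₁ (∧e₂ h)) θ p) (link-below T (∧e₂ (∧e₂ h)) θ p))
  where
  θ : ∀ {u} → u ≺ T → val u ⊩ theory A
  θ = theory-below A T (∧e₁ h)

-- Extending partial models to full ones

Full : Tree → Set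
Full T = ∀ A → val T ⊩ theory A

ArgsIn : (Fm → Set) → Fm → Set
ArgsIn S (■ D) = S D
ArgsIn S _     = ⊤

-- Unlike `Over`, this also enters `■ A`, since `tr` uses both the atom `■ A` and the translation of
-- `A`.
Hered : (Fm → Set) → Fm → Set
Hered Q (var n)  = Q (var n)
Hered Q ⊥'       = ⊤
Hered Q (¬' A)   = Hered Q A
Hered Q (A ∨' B) = Hered Q A × Hered Q B
Hered Q (□ A)    = Hered Q A
Hered Q (■ A)    = Q (■ A) × Hered Q A

Over-tr : ∀ {Q} A → Hered Q A → Over Q (tr A)
Over-tr (var n)  h = h
Over-tr ⊥'       h = tt
Over-tr (¬' A)   h = Over-tr A h
Over-tr (A ∨' B) (h , k) = Over-tr A h , Over-tr B k
Over-tr (□ A)    h = Over-tr A h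
Over-tr (■ A)    (q , h) = (tt , Over-tr A h) , tt , q

Over-link : ∀ {Q} Θ X Y → Over Q X → Over Q Y → Over Q (link Θ X Y)
Over-link {Q} Θ X Y x y = ((x , tt , y) , x , tt , y) , left (GL-decide (Θ ⇒ X))
  where
  left : {A B : Set} (d : A ⊎ B) → Over Q (whenLeft d (□ ⊥' ⇒ Y))
  left (inj₁ _) = tt , y
  left (inj₂ _) = tt

Over-axioms : ∀ {Q} Θ D → Hered Q (■ D) → Over Q (axioms Θ D)
Over-axioms Θ D (q , h) = Over-link Θ (tr D) (■ D) (Over-tr D h) q , Over-link Θ (¬' tr D) (¬' ■ D) (Over-tr D h) q

Over-theory : ∀ {Q} A → Hered Q A → Over Q (theory A)
Over-theory (var n)  h = tt
Over-theory ⊥'       h = tt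
Over-theory (¬' A)   h = Over-theory A h
Over-theory (A ∨' B) (h , k) = Over-theory A h , Over-theory B k
Over-theory (□ A)    h = Over-theory A h
Over-theory (■ A)    h = Over-theory A (proj₂ h) , Over-axioms (theory A) A h

-- Outside S, let ■D have the truth value of D at the terminal nodes.
module Fill {S : Fm → Set} (S? : Decidable S) where

  fillVal : (ℕ → Bool) → (Fm → Bool) → Fm → Bool
  fillVal a b (var n)  = a n
  fillVal a b ⊥'       = false
  fillVal a b (¬' A)   = not (fillVal a b A)
  fillVal a b (A ∨' B) = fillVal a b A ∨ fillVal a b B
  -- The value is meant for terminal nodes, where every box holds.
  fillVal a b (□ A)    = true
  fillVal a b (■ A)    = if does (S? A) then b A else fillVal a b A

  fill : Tree → Tree
  fills : List Tree → List Tree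
  -- Inner nodes are filled alike; `tr` and `link` read `■ D` only under `□ ⊥'`.
  fill (node a b ts) = node a (λ D → fillVal a b (■ D)) (fills ts)
  fills []       = []
  fills (t ∷ ts) = fill t ∷ fills ts

  fill-agree : ∀ T G → Over (ArgsIn S) G → eval (val T) G ≡ eval (val (fill T)) G
  fills-agree : ∀ ts G → Over (ArgsIn S) G → allBelow ts G ≡ allBelow (fills ts) G
  fill-agree (node a b ts) (var n)  o = refl
  fill-agree (node a b ts) ⊥'       o = refl
  fill-agree T (¬' G)   o = cong not (fill-agree T G o)
  fill-agree T (G ∨' H) (o , o′) = cong₂ _∨_ (fill-agree T G o) (fill-agree T H o′)
  fill-agree (node a b ts) (□ G)    o = fills-agree ts G o
  fill-agree (node a b ts) (■ D)    o rewrite dec-true (S? D) o = refl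
  fills-agree []                   G o = refl
  fills-agree (t@(node a b us) ∷ ts) G o =
    cong₂ _∧_ (cong₂ _∧_ (fill-agree t G o) (fills-agree us G o)) (fills-agree ts G o)

  ∈fills⁻ : ∀ ts {t} → t ∈ fills ts → Σ Tree λ t₀ → t ≡ fill t₀
  ∈fills⁻ (t₀ ∷ ts) (here e)  = t₀ , e
  ∈fills⁻ (t₀ ∷ ts) (there m) = ∈fills⁻ ts m

  ≺fill⁻ : ∀ T {u} → u ≺ fill T → Σ Tree λ u₀ → u ≡ fill u₀
  ≺fill⁻ (node a b ts) (child m) = ∈fills⁻ ts m
  ≺fill⁻ (node a b ts) (below p m) with ∈fills⁻ ts m
  ... | t₀ , refl = ≺fill⁻ t₀ p

  terminal-tr : ∀ a b A → eval (val (fill (node a b []))) (tr A) ≡ fillVal a b A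
  terminal-tr a b (var n)  = refl
  terminal-tr a b ⊥'       = refl
  terminal-tr a b (¬' A)   = cong not (terminal-tr a b A)
  terminal-tr a b (A ∨' B) = cong₂ _∨_ (terminal-tr a b A) (terminal-tr a b B)
  terminal-tr a b (□ A)    = refl
  terminal-tr a b (■ A)    = not-involutive _

  terminal-■ : ∀ T D → ¬ S D → val (fill T) ⊩ □ ⊥' → eval (val (fill T)) (tr D) ≡ eval (val (fill T)) (■ D)
  terminal-■ (node a b [])       D ¬s _ rewrite dec-false (S? D) ¬s = terminal-tr a b D
  terminal-■ (node a b (_ ∷ _)) D ¬s (holds ())

  fill-link : ∀ T {Θ X Y} → (∀ u → val (fill u) ⊩ □ ⊥' → val (fill u) ⊩ X → val (fill u) ⊩ Y) →
              val (fill T) ⊩ Θ → val (fill T) ⊩ link Θ X Y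
  fill-link T {Θ} {X} {Y} f θ = link-i (fill T) (spread T)
    (λ u≺T → case ≺fill⁻ T u≺T of λ { (u , refl) → spread u })
    (λ p → ⇒i λ □⊥ → f T □⊥ (⇒e (GL-sound p (fill T)) θ))
    where
    spread : ∀ T → val (fill T) ⊩ □ X → val (fill T) ⊩ □ (□ ⊥' ⇒ Y)
    spread T □X = □i (fill T) λ u≺T → ⇒i λ □⊥ →
      case ≺fill⁻ T u≺T of λ { (u , refl) → f u □⊥ (□e □X u≺T) }

  -- For `D` in `S` the axioms carry over by `fill-agree`; for other `D` the atom `■ D` equals
  -- `tr D` at terminal nodes, which gives both links.
  fill-full : ∀ T → (∀ {D} → S D → Hered (ArgsIn S) D) → (∀ {D} → S D → val T ⊩ axioms (theory D) D) → Full (fill T)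
  fill-full T closed model = go
    where
    go : Full (fill T)
    go (var n)  = ⊤i
    go ⊥'       = ⊤i
    go (¬' A)   = go A
    go (A ∨' B) = ∧i (go A) (go B)
    go (□ A)    = go A
    go (■ D)    = ∧i (go D) (case S? D of λ
      { (yes s) → ⊩-cong (fill-agree T (axioms (theory D) D) (Over-axioms (theory D) D (s , closed s))) (model s)
      ; (no ¬s) → ∧i
          (fill-link T (λ u □⊥ → ⊩-cong (terminal-■ u D ¬s □⊥)) (go D))
          (fill-link T (λ u □⊥ → ⊩-cong (cong not (terminal-■ u D ¬s □⊥))) (go D)) })

args : Fm → List Fm
args (var n)  = []
args ⊥'       = []
args (¬' A)   = args A
args (A ∨' B) = args A ++ args B
args (□ A)    = args A
args (■ A)    = A ∷ args A

Hered-mono : ∀ {S S′ : Fm → Set} A → (∀ {D} → S D → S′ D) → Hered (ArgsIn S) A → Hered (ArgsIn S′) A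
Hered-mono (var n)  f h = tt
Hered-mono ⊥'       f h = tt
Hered-mono (¬' A)   f h = Hered-mono A f h
Hered-mono (A ∨' B) f (h , k) = Hered-mono A f h , Hered-mono B f k
Hered-mono (□ A)    f h = Hered-mono A f h
Hered-mono (■ A)    f (s , h) = f s , Hered-mono A f h

Hered-args : ∀ A → Hered (ArgsIn (_∈ args A)) A
Hered-args (var n)  = tt
Hered-args ⊥'       = tt
Hered-args (¬' A)   = Hered-args A
Hered-args (A ∨' B) = Hered-mono A ∈-++⁺ˡ (Hered-args A) , Hered-mono B (∈-++⁺ʳ (args A)) (Hered-args B)
Hered-args (□ A)    = Hered-args A
Hered-args (■ A)    = here refl , Hered-mono A there (Hered-args A)

args-closed : ∀ A {D} → D ∈ args A → Hered (ArgsIn (_∈ args A)) D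
args-closed (¬' A)   m = args-closed A m
args-closed (A ∨' B) {D} m with ∈-++⁻ (args A) m
... | inj₁ k = Hered-mono D ∈-++⁺ˡ (args-closed A k)
... | inj₂ k = Hered-mono D (∈-++⁺ʳ (args A)) (args-closed B k)
args-closed (□ A)    m = args-closed A m
args-closed (■ A)    (here refl) = Hered-mono A there (Hered-args A)
args-closed (■ A) {D} (there m)  = Hered-mono D there (args-closed A m)

theory-axioms : ∀ A {V D} → V ⊩ theory A → D ∈ args A → V ⊩ axioms (theory D) D
theory-axioms (¬' A)   h m = theory-axioms A h m
theory-axioms (A ∨' B) h m = [ theory-axioms A (∧e₁ h) , theory-axioms B (∧e₂ h) ]′ (∈-++⁻ (args A) m)
theory-axioms (□ A)    h m = theory-axioms A h m
theory-axioms (■ A)    h (here refl) = ∧e₂ h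
theory-axioms (■ A)    h (there m)   = theory-axioms A (∧e₁ h) m

-- Soundness is about full trees, while interpolation controls only the ■-subformulas at hand; this
-- bridges the two.
full-extension : ∀ A T → (∀ {D} → D ∈ args A → val T ⊩ axioms (theory D) D) →
  Σ Tree λ T′ → Full T′ × (∀ G → Over (ArgsIn (_∈ args A)) G → eval (val T) G ≡ eval (val T′) G)
full-extension A T model = fill T , fill-full T (args-closed A) model , fill-agree T
  where open Fill (_∈? args A)

-- Soundness of GR

pull : Val → Val
pull V = record { atom = Val.atom V ; box = λ A → eval V (tr (□ A)) ; bbox = λ A → eval V (tr (■ A)) }

eval-pull : ∀ V A → eval (pull V) A ≡ eval V (tr A)
eval-pull V (var n)  = refl
eval-pull V ⊥'       = refl
eval-pull V (¬' A)   = cong not (eval-pull V A)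
eval-pull V (A ∨' B) = cong₂ _∨_ (eval-pull V A) (eval-pull V B)
eval-pull V (□ A)    = refl
eval-pull V (■ A)    = refl

tr-■i : ∀ {V A} → V ⊩ □ tr A → (V ⊩ □ ⊥' → V ⊩ ■ A) → V ⊩ tr (■ A)
tr-■i {V} p f = case V ⊩? (□ ⊥') of λ
  { (yes q) → ∨i₂ (∧i q (f q))
  ; (no ¬q) → ∨i₁ (∧i (¬i ¬q) p) }

-- A countermodel to `theory D ⇒ X` satisfies `theory D`, so it extends to a full tree still
-- refuting `X`. If there is none, `T` serves.
refuter : ∀ T → Full T → ∀ D X → Over (ArgsIn (_∈ args D)) X →
          Σ Tree λ t → Full t × (val t ⊩ X → GL (theory D ⇒ X))
refuter T full D X o = case GL-decide (theory D ⇒ X) of λ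
  { (inj₁ p)       → T , full , λ _ → p
  ; (inj₂ (U , c)) →
      case full-extension D U (theory-axioms D (⊩-stable λ ¬θ → c (⇒i λ θ → ⊥-elim (¬θ θ)))) of λ
      { (U′ , full′ , same) → U′ , full′ , λ x → ⊥-elim (c (⇒i λ _ → ⊩-cong (sym (same X o)) x)) } }

-- A full model lies above a root that also sees refutations of everything GL does not
-- derive from the axioms about the ■-subformulas of A, so no new demands arise at the root.
full-predecessor : ∀ A T → Full T → Σ Tree λ R → T ∈ children R × (∀ {D} → D ∈ args A → val R ⊩ axioms (theory D) D)
full-predecessor A T full =
  case choose {P = λ D t → Full t × (val t ⊩ tr D → GL (theory D ⇒ tr D))} (args A)
         (λ {D} _ → refuter T full D (tr D) (Over-tr D (Hered-args D))) of λ { (ts₁ , f₁ , g₁) →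
  case choose {P = λ D t → Full t × (val t ⊩ ¬' tr D → GL (theory D ⇒ ¬' tr D))} (args A)
         (λ {D} _ → refuter T full D (¬' tr D) (Over-tr D (Hered-args D))) of λ { (ts₂ , f₂ , g₂) →
  let R = node (λ _ → false) (λ _ → false) (T ∷ ts₁ ++ ts₂)
      all-full : ∀ {t} → t ∈ children R → Full t
      all-full = λ { (here refl) → full
                   ; (there m) → [ (λ k → case g₁ k of λ { (_ , _ , h , _) → h })
                                 , (λ k → case g₂ k of λ { (_ , _ , h , _) → h }) ]′ (∈-++⁻ ts₁ m) }
  in R , here refl , λ {D} m →
     case f₁ m of λ { (t₁ , k₁ , _ , h₁) → case f₂ m of λ { (t₂ , k₂ , _ , h₂) →
       ∧i (link-root R (λ k → ∧e₁ (∧e₂ (all-full k (■ D)))) (there (∈-++⁺ˡ k₁)) h₁)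
          (link-root R (λ k → ∧e₂ (∧e₂ (all-full k (■ D)))) (there (∈-++⁺ʳ ts₁ k₂)) h₂) } } } }

GR-sound : ∀ {r A} → Prf r A → ∀ T → Full T → val T ⊩ tr A
GR-sound (taut {A} t) T full = holds (trans (sym (eval-pull (val T) A)) (t (pull (val T))))
GR-sound axK T full = K-valid T
GR-sound axL T full = Löb-valid T
GR-sound ax1 T full = ⇒i λ h → case ∨e h of λ
  { (inj₁ p) → ∧e₂ p
  ; (inj₂ p) → □i T λ u≺T → ⊥-elim (⊥e (□e (∧e₁ p) u≺T)) }
GR-sound (ax2 {A}) T full = ⇒i λ p → □i T λ u≺T →
  tr-■i (□-trans p u≺T) (⇒e (□e (link-here (∧e₁ (∧e₂ (full (■ A)))) p) u≺T))
GR-sound ax3 T full = ⇒i λ p → case val T ⊩? (□ ⊥') of λ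
  { (yes q) → ∨i₁ q
  ; (no ¬q) → ∨i₂ (tr-■i p (λ q → ⊥-elim (¬q q))) }
GR-sound (ax4 {A}) T full = ⇒i λ p → ¬i λ n → case ◇e T p of λ { (u , u≺T , h) → case ∨e h of λ
  -- If `u` is not terminal, `□ A` there puts `A` at a node below it, against `□ (¬' A)` at `T`. If
  -- it is terminal, the link for `¬' A` denies `■ A`.
  { (inj₁ q) → case least-counterexample u (¬e (∧e₁ q)) of λ
      { (v , v≺u , _) → ¬e (□e n (≺-trans v≺u u≺T)) (□e (∧e₂ q) v≺u) }
  ; (inj₂ q) → ¬e (⇒e (□e (link-here (∧e₂ (∧e₂ (full (■ A)))) n) u≺T) (∧e₁ q)) (∧e₂ q) } }
GR-sound (mp p q) T full = ⇒e (GR-sound p T full) (GR-sound q T full)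
GR-sound (nec p)  T full = □i T λ {u} u≺T → GR-sound p u λ A → theory-below A T (full A) u≺T
-- The root `R` above `T` satisfies the axioms for `A` only, so the induction hypothesis is used on
-- its full extension and `□ tr A` is carried back to `R`.
GR-sound (refl□ {A} _ p) T full = case full-predecessor A T full of λ { (R , m , model) →
  case full-extension A R model of λ { (R′ , full′ , same) →
    proj₁ (□e-children R (⊩-cong (sym (same (□ tr A) (Over-tr A (Hered-args A)))) (GR-sound p R′ full′)) m) } }

-- Derivations in GR

GR-prop₀ : ∀ {A} → (∀ V → V ⊩ A) → GR⊢ A
GR-prop₀ h = taut λ V → true≡ (h V)

GR-prop₁ : ∀ {A B} → (∀ V → V ⊩ A → V ⊩ B) → GR⊢ A → GR⊢ B
GR-prop₁ h p = mp (GR-prop₀ λ V → ⇒i (h V)) p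

GR-prop₂ : ∀ {A B C} → (∀ V → V ⊩ A → V ⊩ B → V ⊩ C) → GR⊢ A → GR⊢ B → GR⊢ C
GR-prop₂ h p q = mp (GR-prop₁ (λ V a → ⇒i (h V a)) p) q

GR-trans : ∀ {A B C} → GR⊢ (A ⇒ B) → GR⊢ (B ⇒ C) → GR⊢ (A ⇒ C)
GR-trans = GR-prop₂ λ _ f g → ⇒i λ a → ⇒e g (⇒e f a)

GR-contra : ∀ {A B} → GR⊢ (A ⇒ B) → GR⊢ (¬' B ⇒ ¬' A)
GR-contra = GR-prop₁ λ _ f → ⇒i λ nb → ¬i λ a → ¬e nb (⇒e f a)

GR-□ : ∀ {A B} → GR⊢ (A ⇒ B) → GR⊢ (□ A ⇒ □ B)
GR-□ p = mp axK (nec p)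

-- Mutual because negation swaps the directions. For `■ A`, `ax1` gives the forward direction and
-- `ax3` the backward one.
tr⁺ : ∀ A → GR⊢ (A ⇒ tr A)
tr⁻ : ∀ A → GR⊢ (tr A ⇒ A)

tr⁺ (var n)  = GR-prop₀ (λ _ → ⇒i λ p → p)
tr⁺ ⊥'       = GR-prop₀ (λ _ → ⇒i λ p → p)
tr⁺ (¬' A)   = GR-contra (tr⁻ A)
tr⁺ (A ∨' B) = GR-prop₂ (λ _ f g → ⇒i λ h → [ (λ a → ∨i₁ (⇒e f a)) , (λ b → ∨i₂ (⇒e g b)) ]′ (∨e h)) (tr⁺ A) (tr⁺ B)
tr⁺ (□ A)    = GR-□ (tr⁺ A)
tr⁺ (■ A)    = GR-prop₁ (λ V f → ⇒i λ p → tr-■i (⇒e f p) λ _ → p) (GR-trans ax1 (GR-□ (tr⁺ A)))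

tr⁻ (var n)  = GR-prop₀ (λ _ → ⇒i λ p → p)
tr⁻ ⊥'       = GR-prop₀ (λ _ → ⇒i λ p → p)
tr⁻ (¬' A)   = GR-contra (tr⁺ A)
tr⁻ (A ∨' B) = GR-prop₂ (λ _ f g → ⇒i λ h → [ (λ a → ∨i₁ (⇒e f a)) , (λ b → ∨i₂ (⇒e g b)) ]′ (∨e h)) (tr⁻ A) (tr⁻ B)
tr⁻ (□ A)    = GR-□ (tr⁻ A)
tr⁻ (■ A)    = GR-prop₁ (λ V f → ⇒i λ h → case ∨e h of λ
  { (inj₁ p) → [ (λ q → ⊥-elim (¬e (∧e₁ p) q)) , (λ q → q) ]′ (∨e (⇒e f (∧e₂ p)))
  ; (inj₂ p) → ∧e₂ p }) (GR-trans (GR-□ (tr⁻ A)) ax3)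

GR-link : ∀ {Θ X Y} → GR⊢ Θ → GR⊢ (□ X ⇒ □ Y) → GR⊢ link Θ X Y
GR-link {Θ} {X} {Y} θ p = GR-prop₂ (λ _ → ∧i) (GR-prop₂ (λ _ → ∧i) q (nec q)) (left (GL-decide (Θ ⇒ X)))
  where
  q : GR⊢ (□ X ⇒ □ (□ ⊥' ⇒ Y))
  q = GR-trans p (GR-□ (GR-prop₀ (λ _ → ⇒i λ y → ⇒i λ _ → y)))
  left : {Q : Set} (d : GL (Θ ⇒ X) ⊎ Q) → GR⊢ whenLeft d (□ ⊥' ⇒ Y)
  -- The reflection rule enters here: `X` is a theorem, hence so are `□ X` and `□ Y`, hence `Y`.
  left (inj₁ g) = GR-prop₁ (λ _ y → ⇒i λ _ → y) (refl□ refl (mp p (nec (mp (GL⇒Prf g) θ))))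
  left (inj₂ _) = GR-prop₀ λ _ → ⊤i

GR-theory : ∀ A → GR⊢ theory A
GR-theory (var n)  = GR-prop₀ λ _ → ⊤i
GR-theory ⊥'       = GR-prop₀ λ _ → ⊤i
GR-theory (¬' A)   = GR-theory A
GR-theory (A ∨' B) = GR-prop₂ (λ _ → ∧i) (GR-theory A) (GR-theory B)
GR-theory (□ A)    = GR-theory A
GR-theory (■ A)    = GR-prop₂ (λ _ → ∧i) (GR-theory A) (GR-prop₂ (λ _ → ∧i)
  -- The first link rests on `ax2`, the second on the contrapositive of `ax4`.
  (GR-link (GR-theory A) (GR-trans (GR-□ (tr⁻ A)) ax2))
  (GR-link (GR-theory A) (GR-trans (GR-□ (GR-contra (tr⁺ A)))
    (GR-prop₁ (λ _ f → ⇒i λ n → ⊩-stable λ ¬p → ¬e (⇒e f (¬i ¬p)) n) ax4))))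

-- Variables

-- Also serves as the predicate of kept atoms: an atom `■ D` is kept only if no variable of `D` is
-- to be eliminated.
AllVars : (ℕ → Set) → Fm → Set
AllVars R A = ∀ n → n occursIn A → R n

allVars? : ∀ {R} → Decidable R → Decidable (AllVars R)
allVars? R? (var n)  = map′ (λ { p _ here → p }) (λ h → h n here) (R? n)
allVars? R? ⊥'       = yes λ _ ()
allVars? R? (¬' A)   = map′ (λ { h n (inNeg o) → h n o }) (λ h n o → h n (inNeg o)) (allVars? R? A)
allVars? R? (A ∨' B) = map′ (λ { (h , k) n (inOrL o) → h n o ; (h , k) n (inOrR o) → k n o })
  (λ h → (λ n o → h n (inOrL o)) , (λ n o → h n (inOrR o))) (allVars? R? A ×-dec allVars? R? B)
allVars? R? (□ A)    = map′ (λ { h n (inBox o) → h n o }) (λ h n o → h n (inBox o)) (allVars? R? A)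
allVars? R? (■ A)    = map′ (λ { h n (inBBox o) → h n o }) (λ h n o → h n (inBBox o)) (allVars? R? A)

Hered-vars : ∀ {R} A → AllVars R A → Hered (AllVars R) A
Hered-vars (var n)  h = h
Hered-vars ⊥'       h = tt
Hered-vars (¬' A)   h = Hered-vars A λ n o → h n (inNeg o)
Hered-vars (A ∨' B) h = Hered-vars A (λ n o → h n (inOrL o)) , Hered-vars B (λ n o → h n (inOrR o))
Hered-vars (□ A)    h = Hered-vars A λ n o → h n (inBox o)
Hered-vars (■ A)    h = h , Hered-vars A λ n o → h n (inBBox o)

Over-vars : ∀ {R} A → Over (AllVars R) A → AllVars R A
Over-vars (var n)  o = o
Over-vars (¬' A)   o n (inNeg p) = Over-vars A o n p
Over-vars (A ∨' B) o n (inOrL p) = Over-vars A (proj₁ o) n p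
Over-vars (A ∨' B) o n (inOrR p) = Over-vars B (proj₂ o) n p
Over-vars (□ A)    o n (inBox p) = Over-vars A o n p
Over-vars (■ A)    o = o

Over-lookup : ∀ {Q a} A → Over Q A → a ∈ atoms A → Q a
Over-lookup (var n)  o (here refl) = o
Over-lookup (¬' A)   o m = Over-lookup A o m
Over-lookup (A ∨' B) o m = [ Over-lookup A (proj₁ o) , Over-lookup B (proj₂ o) ]′ (∈-++⁻ (atoms A) m)
Over-lookup (□ A)    o m = Over-lookup A o m
Over-lookup (■ A)    o (here refl) = o

Over-map : ∀ {Q Q′ : Fm → Set} A → (∀ {a} → Q a → Q′ a) → Over Q A → Over Q′ A
Over-map (var n)  f o = f o
Over-map ⊥'       f o = tt
Over-map (¬' A)   f o = Over-map A f o
Over-map (A ∨' B) f (o , o′) = Over-map A f o , Over-map B f o′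
Over-map (□ A)    f o = Over-map A f o
Over-map (■ A)    f o = f o

-- `theory (A ⇒ B)` is by definition `theory A ∧' theory B`, so the axioms can be divided between
-- the two sides. A tree satisfying both extends to a full one, where soundness applies.
GR-valid : ∀ A B → GR⊢ (A ⇒ B) → Valid ((theory A ∧' tr A) ⇒ (theory B ⇒ tr B))
GR-valid A B p T = ⇒i λ a → ⇒i λ b →
  case full-extension (A ⇒ B) T (theory-axioms (A ⇒ B) (∧i (∧e₁ a) b)) of λ { (T′ , full , same) →
    ⇒e (⊩-cong (sym (same (tr (A ⇒ B)) (Over-tr (A ⇒ B) (Hered-args (A ⇒ B))))) (GR-sound p T′ full)) (∧e₂ a) }

theorem6p8 : (A : Fm) (P : List ℕ) →
    Σ Fm (λ C →
      ((n : ℕ) → n occursIn C → (n occursIn A) × (¬ (n ∈ P)))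
      × (GR⊢ (A ⇒ C))
      × ((B : Fm) → GR⊢ (A ⇒ B) → ((n : ℕ) → n occursIn B → ¬ (n ∈ P)) → GR⊢ (C ⇒ B)))
theorem6p8 A P =
  case GL-uniform-interpolation F (allVars? (λ n → ¬? (n ∈ℕ? P))) of λ { (C , over , F⇒C , least) →
    C
  , Over-vars C (Over-map C (λ { (m , k) n o → Over-lookup F F-vars m n o , k n o }) over)
  -- GR proves `theory A` and `A ⇒ tr A`, so `A` implies `F` there.
  , GR-trans (GR-prop₂ (λ _ θ f → ⇒i λ a → ∧i θ (⇒e f a)) (GR-theory A) (tr⁺ A)) (GL⇒Prf (GL-complete F⇒C))
  , λ B p v →
      GR-trans
        -- The theory of `B` moves to the consequent; its atoms are kept, as `B` avoids `P`.
        (GL⇒Prf (GL-complete (least (theory B ⇒ tr B)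
          (Over-theory B (Hered-vars B v) , Over-tr B (Hered-vars B v)) (GR-valid A B p))))
        (GR-prop₂ (λ _ θ f → ⇒i λ g → ⇒e f (⇒e g θ)) (GR-theory B) (tr⁻ B)) }
  where
  F : Fm
  F = theory A ∧' tr A
  F-vars : Over (AllVars (_occursIn A)) F
  F-vars = Over-theory A self , Over-tr A self
    where self = Hered-vars A λ _ o → o
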